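{- Let $\mathcal{K}$ be a finite class of similar finite smooth idempotent algebras, let $\mathbb{A}_1,\mathbb{A}_2\in\mathcal{K}$, and let $ab$ and $cd$ be thin affine edges in $\mathbb{A}_1,\mathbb{A}_2$, respectively. Then there is a ternary term operation $h'$ such that $h'(b,a,a)=b$ and $h'(c,c,d)=d$. In particular, for any thin affine edge $ab$ there is a term operation $h'$ such that $h'(b,a,a)=h'(a,a,b)=b$.
   Context: $\mathsf{Sg}\{a,b\}$ is the subalgebra generated by $a,b$. For a congruence $\theta$ of $\mathsf{Sg}\{a,b\}$, $a/\theta$ is the $\theta$-block of $a$ and $f/\theta$ the operation induced by $f$ on the quotient. An algebra is called a module if it is term equivalent to the full idempotent reduct of a module over a ring (the reduct whose operations are all idempotent term operations of that module), with affine operation $x-y+z$. Edges: a pair $ab$ of distinct elements of an idempotent algebra is a semilattice edge witnessed by a congruence $\theta$ of $\mathsf{Sg}\{a,b\}$ with $a/\theta\ne b/\theta$ if some binary term operation induces a semilattice operation on $\{a/\theta,b/\theta\}$; a majority edge witnessed by $\theta$ if some ternary term operation induces a majority operation on $\{a/\theta,b/\theta\}$ but no term operation induces a semilattice operation there; an affine edge witnessed by $\theta$ if $\mathsf{Sg}\{a,b\}/\theta$ is a module and some term operation induces its operation $x-y+z$. In each case $E=\{a/\theta,b/\theta\}$ is a thick edge of that type. An idempotent algebra is smooth if for every thick edge $\{a/\theta,b/\theta\}$ of semilattice or majority type the set $a/\theta\cup b/\theta$ is a subuniverse. Fix term operations $f$ (binary), $g,h$ (ternary) of $\mathcal{K}$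 such that for every thick edge $E=\{a/\theta,b/\theta\}$ of every $\mathbb{A}\in\mathcal{K}$: if $E$ is semilattice, $f$ is a semilattice operation on $E$ and $g(x,y,z)=h(x,y,z)=f(x,f(y,z))$ on $E$; if $E$ is majority, on $E$ $f,h$ are first projections and $g$ is a majority operation; if $E$ is affine, $f,g$ are first projections on $E$ and $h/\theta$ is $x-y+z$ on $\mathsf{Sg}\{a,b\}/\theta$; and the identities $f(x,f(x,y))=f(x,y)$, $g(x,g(x,y,y),g(x,y,y))=g(x,y,y)$, $h(h(x,y,y),y,y)=h(x,y,y)$ hold in $\mathcal{K}$. (Such operations exist.) A ternary term operation $h'$ satisfies the minority condition (with respect to $\mathcal{K}$) if $h'(h'(x,y,y),y,y)=h'(x,y,y)$ holds in $\mathcal{K}$ and for every affine edge $ab$ of any $\mathbb{B}\in\mathcal{K}$ witnessed by $\theta$, $h'/\theta$ is a Mal'tsev operation on $\mathsf{Sg}\{a,b\}/\theta$. A pair $ab$ of distinct elements of $\mathbb{A}\in\mathcal{K}$ is a thin affine edge (with respect to $\mathcal{K}$) if $h(b,a,a)=b$ for the fixed operation $h$ and $b\in\mathsf{Sg}\{a,h'(a,a,b)\}$ for every term operation $h'$ satisfying the minority condition. -}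

module Defs where

open import Algebra.Bundles using (Ring)
open import Algebra.Lattice.Structures using (IsSemilattice)
open import Algebra.Module.Structures using (IsLeftModule)
open import Data.Fin using (Fin; zero; suc)
open import Data.Fin.Patterns using (0F; 1F; 2F)
open import Data.Nat using (ℕ)
open import Data.Product using (Σ; ∃; Σ-syntax; ∃-syntax; _×_; _,_; proj₁; proj₂)
open import Data.Sum using (_⊎_)
open import Data.Vec.Functional using (Vector; []; _∷_)
open import Function using (_∘_; _on_; const)
open import Function.Bundles using (Inverse)
open import Level using (0ℓ)
open import Relation.Binary using (Rel; Setoid; IsEquivalence)
open import Relation.Binary.PropositionalEquality using (_≡_; setoid)
open import Relation.Nullary using (¬_)
open import Relation.Unary using (Pred; _∈_)

import Relation.Binary.Construct.On as On

------------------------------------------------------------------------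
-- Universal algebra

record Signature : Set₁ where
  field
    Op : Set
    ar : Op → ℕ

open Signature public

data Term (S : Signature) (n : ℕ) : Set where
  var : Fin n → Term S n
  app : (o : Op S) → (Fin (ar S o) → Term S n) → Term S n

-- Equality is a setoid equality so that A/θ can be A with the equality θ.
record Interpretation (S : Signature) (X : Setoid 0ℓ 0ℓ) : Set where
  open Setoid X
  field
    op      : (o : Op S) → Vector Carrier (ar S o) → Carrier
    op-cong : ∀ o {u v} → (∀ i → u i ≈ v i) → op o u ≈ op o v

  eval : ∀ {n} → Term S n → Vector Carrier n → Carrier
  eval (var i)    v = v i
  eval (app o ts) v = op o λ i → eval (ts i) v

record Algebra (S : Signature) : Set₁ where
  field
    universe       : Setoid 0ℓ 0ℓ
    interpretation : Interpretation S universe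

  open Setoid universe public
  open Interpretation interpretation public

  ⟦_⟧₂ : Term S 2 → Carrier → Carrier → Carrier
  ⟦ t ⟧₂ x y = eval t (x ∷ y ∷ [])

  ⟦_⟧₃ : Term S 3 → Carrier → Carrier → Carrier → Carrier
  ⟦ t ⟧₃ x y z = eval t (x ∷ y ∷ z ∷ [])

-- Two interpretations, possibly of different signatures, on the same set.
TermEquivalent : ∀ {S T X} → Interpretation S X → Interpretation T X → Set
TermEquivalent {S} {T} {X} I J =
  (∀ {n} (t : Term S n) → Σ[ u ∈ Term T n ] ∀ v → I.eval t v ≈ J.eval u v) ×
  (∀ {n} (u : Term T n) → Σ[ t ∈ Term S n ] ∀ v → J.eval u v ≈ I.eval t v)
  where
  open Setoid X
  module I = Interpretation I
  module J = Interpretation J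

eval-cong : ∀ {S X} (I : Interpretation S X) → let open Setoid X; open Interpretation I in
            ∀ {n} (t : Term S n) {u v} → (∀ i → u i ≈ v i) → eval t u ≈ eval t v
eval-cong I (var i)    e = e i
eval-cong I (app o ts) e = Interpretation.op-cong I o λ i → eval-cong I (ts i) e

module _ {S : Signature} where

  IsFinite : Algebra S → Set
  IsFinite 𝔸 = ∃[ n ] Inverse (Algebra.universe 𝔸) (setoid (Fin n))

  IsIdempotent : Algebra S → Set
  IsIdempotent 𝔸 = ∀ o x → op o (const x) ≈ x
    where open Algebra 𝔸

  module _ (𝔸 : Algebra S) where
    open Algebra 𝔸

    IsSubuniverse : Pred Carrier 0ℓ → Set
    IsSubuniverse P =
      (∀ {x y} → x ≈ y → x ∈ P → y ∈ P) ×
      (∀ o v → (∀ i → v i ∈ P) → op o v ∈ P)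

    data Sg (a b : Carrier) : Pred Carrier 0ℓ where
      genˡ : a ∈ Sg a b
      genʳ : b ∈ Sg a b
      resp : ∀ {x y} → x ≈ y → x ∈ Sg a b → y ∈ Sg a b
      app  : ∀ o v → (∀ i → v i ∈ Sg a b) → op o v ∈ Sg a b

    SgAlgebra : Carrier → Carrier → Algebra S
    SgAlgebra a b = record
      { universe = record
        { Carrier       = Σ Carrier (Sg a b)
        ; _≈_           = _≈_ on proj₁
        ; isEquivalence = On.isEquivalence proj₁ isEquivalence
        }
      ; interpretation = record
        { op      = λ o v → op o (proj₁ ∘ v) , app o (proj₁ ∘ v) (proj₂ ∘ v)
        ; op-cong = λ o → op-cong o
        }
      }

    record Congruence : Set₁ where
      field
        _∼_             : Rel Carrier 0ℓ
        ∼-isEquivalence : IsEquivalence _∼_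
        ≈⇒∼             : ∀ {x y} → x ≈ y → x ∼ y
        compatible      : ∀ o {u v} → (∀ i → u i ∼ v i) → op o u ∼ op o v

    Quotient : Congruence → Algebra S
    Quotient θ = record
      { universe       = record { Carrier = Carrier ; _≈_ = _∼_ ; isEquivalence = ∼-isEquivalence }
      ; interpretation = record { op = op ; op-cong = compatible }
      }
      where open Congruence θ

------------------------------------------------------------------------
-- Modules

data ModuleOp (R : Set) : Set where
  zeroOp addOp negOp : ModuleOp R
  scaleOp            : R → ModuleOp R

moduleSignature : Set → Signature
moduleSignature R = record
  { Op = ModuleOp R
  ; ar = λ { zeroOp → 0 ; addOp → 2 ; negOp → 1 ; (scaleOp _) → 1 }
  }

record ModuleStructure (X : Setoid 0ℓ 0ℓ) : Set₁ where
  open Setoid X using (Carrier; _≈_)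
  field
    ring         : Ring 0ℓ 0ℓ
    _+ᴹ_         : Carrier → Carrier → Carrier
    0ᴹ           : Carrier
    -ᴹ_          : Carrier → Carrier
    _*ₗ_         : Ring.Carrier ring → Carrier → Carrier
    isLeftModule : IsLeftModule ring _≈_ _+ᴹ_ 0ᴹ -ᴹ_ _*ₗ_

  open IsLeftModule isLeftModule

  affine : Carrier → Carrier → Carrier → Carrier
  affine x y z = (x +ᴹ (-ᴹ y)) +ᴹ z

  interpretation : Interpretation (moduleSignature (Ring.Carrier ring)) X
  interpretation = record
    { op = λ
        { zeroOp      v → 0ᴹ
        ; addOp       v → v 0F +ᴹ v 1F
        ; negOp       v → -ᴹ v 0F
        ; (scaleOp r) v → r *ₗ v 0F
        }
    ; op-cong = λ
        { zeroOp      e → Setoid.refl X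
        ; addOp       e → +ᴹ-cong (e 0F) (e 1F)
        ; negOp       e → -ᴹ‿cong (e 0F)
        ; (scaleOp r) e → *ₗ-cong (Ring.refl ring) (e 0F)
        }
    }

-- The full idempotent reduct has one basic operation for each term whose
-- term operation is idempotent.
module _ {T : Signature} {X : Setoid 0ℓ 0ℓ} (I : Interpretation T X) where
  open Setoid X
  open Interpretation I

  idempotentReductSignature : Signature
  idempotentReductSignature = record
    { Op = Σ[ n ∈ ℕ ] Σ[ t ∈ Term T n ] ∀ x → eval t (const x) ≈ x
    ; ar = proj₁
    }

  idempotentReduct : Interpretation idempotentReductSignature X
  idempotentReduct = record
    { op      = λ (_ , t , _) → eval t
    ; op-cong = λ (_ , t , _) → eval-cong I t
    }

record IsModule {S : Signature} (𝔸 : Algebra S) : Set₁ where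
  open Algebra 𝔸 using (universe; interpretation)
  field
    moduleStructure : ModuleStructure universe

  open ModuleStructure moduleStructure public using (affine)

  field
    termEquivalent :
      TermEquivalent interpretation
        (idempotentReduct (ModuleStructure.interpretation moduleStructure))

------------------------------------------------------------------------
-- Operations induced on a subset E

module _ {S : Signature} (𝔸 : Algebra S) (E : Pred (Algebra.Carrier 𝔸) 0ℓ) where
  open Algebra 𝔸

  InducesSemilattice : Term S 2 → Set
  InducesSemilattice t =
    Σ[ closed ∈ (∀ {x y} → x ∈ E → y ∈ E → ⟦ t ⟧₂ x y ∈ E) ]
      IsSemilattice {A = Σ Carrier E} (_≈_ on proj₁)
        (λ (x , x∈E) (y , y∈E) → ⟦ t ⟧₂ x y , closed x∈E y∈E)

  -- The equations put ⟦ t ⟧₃ x y z in E only when two arguments are equal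
  -- in E, which always happens on the two-element sets where this is used.
  InducesMajority : Term S 3 → Set
  InducesMajority t = ∀ {x y} → x ∈ E → y ∈ E →
    ⟦ t ⟧₃ x x y ≈ x × ⟦ t ⟧₃ x y x ≈ x × ⟦ t ⟧₃ y x x ≈ x

  FirstProjection₂ : Term S 2 → Set
  FirstProjection₂ t = ∀ {x y} → x ∈ E → y ∈ E → ⟦ t ⟧₂ x y ≈ x

  FirstProjection₃ : Term S 3 → Set
  FirstProjection₃ t = ∀ {x y z} → x ∈ E → y ∈ E → z ∈ E → ⟦ t ⟧₃ x y z ≈ x

IsMaltsev : ∀ {S} (𝔸 : Algebra S) → Term S 3 → Set
IsMaltsev 𝔸 t = ∀ x y → ⟦ t ⟧₃ x y y ≈ x × ⟦ t ⟧₃ y y x ≈ x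
  where open Algebra 𝔸

------------------------------------------------------------------------
-- Edges

module _ {S : Signature} (𝔸 : Algebra S) (a b : Algebra.Carrier 𝔸)
         (θ : Congruence (SgAlgebra 𝔸 a b)) where
  open Congruence θ using (_∼_)

  Sg/ : Algebra S
  Sg/ = Quotient (SgAlgebra 𝔸 a b) θ

  a/ b/ : Algebra.Carrier Sg/
  a/ = a , genˡ
  b/ = b , genʳ

  -- {a/θ, b/θ}, as a subset of Sg{a,b}/θ
  ThickEdge : Pred (Algebra.Carrier Sg/) 0ℓ
  ThickEdge x = x ∼ a/ ⊎ x ∼ b/

  -- a/θ ∪ b/θ, as a subset of 𝔸
  BlockUnion : Pred (Algebra.Carrier 𝔸) 0ℓ
  BlockUnion x = Σ[ x∈Sg ∈ x ∈ Sg 𝔸 a b ] ThickEdge (x , x∈Sg)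

  -- a/θ ≠ b/θ already makes a and b distinct.
  IsSemilatticeEdge : Set
  IsSemilatticeEdge =
    ¬ (a/ ∼ b/) × (∃[ t ] InducesSemilattice Sg/ ThickEdge t)

  IsMajorityEdge : Set
  IsMajorityEdge =
    ¬ (a/ ∼ b/) ×
    (∃[ t ] InducesMajority Sg/ ThickEdge t) ×
    ¬ (∃[ t ] InducesSemilattice Sg/ ThickEdge t)

  record IsAffineEdge : Set₁ where
    open Algebra Sg/ using (_≈_; ⟦_⟧₃)
    field
      distinct : ¬ (a/ ∼ b/)
      isModule : IsModule Sg/

    open IsModule isModule public using (affine)

    field
      affineTerm : Σ[ t ∈ Term S 3 ] ∀ x y z → ⟦ t ⟧₃ x y z ≈ affine x y z

IsSmooth : ∀ {S} → Algebra S → Set₁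
IsSmooth 𝔸 = ∀ a b θ →
  IsSemilatticeEdge 𝔸 a b θ ⊎ IsMajorityEdge 𝔸 a b θ →
  IsSubuniverse 𝔸 (BlockUnion 𝔸 a b θ)

------------------------------------------------------------------------
-- The fixed operations and thin affine edges, for a finite class 𝒦
-- enumerated by Fin k

module _ {S : Signature} {k : ℕ} (𝒦 : Fin k → Algebra S) where

  record FixedOperations : Set₁ where
    field
      f   : Term S 2
      g h : Term S 3

      onSemilattice : ∀ i a b θ → IsSemilatticeEdge (𝒦 i) a b θ →
        let E = ThickEdge (𝒦 i) a b θ
            open Algebra (Sg/ (𝒦 i) a b θ)
        in InducesSemilattice (Sg/ (𝒦 i) a b θ) E f ×
           (∀ {x y z} → x ∈ E → y ∈ E → z ∈ E →
             ⟦ g ⟧₃ x y z ≈ ⟦ f ⟧₂ x (⟦ f ⟧₂ y z) ×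
             ⟦ h ⟧₃ x y z ≈ ⟦ f ⟧₂ x (⟦ f ⟧₂ y z))

      onMajority : ∀ i a b θ → IsMajorityEdge (𝒦 i) a b θ →
        let E = ThickEdge (𝒦 i) a b θ
            Q = Sg/ (𝒦 i) a b θ
        in FirstProjection₂ Q E f × FirstProjection₃ Q E h × InducesMajority Q E g

      -- x - y + z is the only Mal'tsev term operation of the quotient, so it
      -- does not depend on which module structure e carries.
      onAffine : ∀ i a b θ (e : IsAffineEdge (𝒦 i) a b θ) →
        let E = ThickEdge (𝒦 i) a b θ
            Q = Sg/ (𝒦 i) a b θ
            open Algebra Q
        in FirstProjection₂ Q E f × FirstProjection₃ Q E g ×
           (∀ x y z → ⟦ h ⟧₃ x y z ≈ IsAffineEdge.affine e x y z)

      f-identity : ∀ i → let open Algebra (𝒦 i) in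
        ∀ x y → ⟦ f ⟧₂ x (⟦ f ⟧₂ x y) ≈ ⟦ f ⟧₂ x y

      g-identity : ∀ i → let open Algebra (𝒦 i) in
        ∀ x y → ⟦ g ⟧₃ x (⟦ g ⟧₃ x y y) (⟦ g ⟧₃ x y y) ≈ ⟦ g ⟧₃ x y y

      h-identity : ∀ i → let open Algebra (𝒦 i) in
        ∀ x y → ⟦ h ⟧₃ (⟦ h ⟧₃ x y y) y y ≈ ⟦ h ⟧₃ x y y

  MinorityCondition : Term S 3 → Set₁
  MinorityCondition h′ =
    (∀ i → let open Algebra (𝒦 i) in
      ∀ x y → ⟦ h′ ⟧₃ (⟦ h′ ⟧₃ x y y) y y ≈ ⟦ h′ ⟧₃ x y y) ×
    (∀ i a b θ → IsAffineEdge (𝒦 i) a b θ → IsMaltsev (Sg/ (𝒦 i) a b θ) h′)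

  IsThinAffineEdge : FixedOperations → ∀ i → (a b : Algebra.Carrier (𝒦 i)) → Set₁
  IsThinAffineEdge F i a b =
    ¬ (a ≈ b) ×
    ⟦ h ⟧₃ b a a ≈ b ×
    (∀ h′ → MinorityCondition h′ → b ∈ Sg (𝒦 i) a (⟦ h′ ⟧₃ a a b))
    where
    open Algebra (𝒦 i)
    open FixedOperations F using (h)

{-# OPTIONS --safe #-}
module Submission where

open import Defs
open import Algebra.Bundles using (Group)
open import Algebra.Module.Structures using (IsLeftModule)
open import Data.Fin using (Fin)
open import Data.Fin.Patterns using (0F; 1F)
open import Data.Nat using (ℕ)
open import Data.Product using (Σ-syntax; ∃-syntax; _×_; _,_; proj₁; proj₂)
open import Data.Vec.Functional using (Vector; []; _∷_)
open import Level using (0ℓ)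
open import Relation.Binary using (Setoid)
open import Relation.Unary using (_∈_)

import Algebra.Properties.Group as GroupProperties

-- The term h is itself subject to the minority condition, so thinness of cd gives
-- a binary term r with r(c, h(c,c,d)) = d.  The term r(x, h(x,y,z)) sends (c,c,d)
-- to d, and it sends (b,a,a) to r(b,b) = b since h(b,a,a) = b.

module _ {S : Signature} where

  -- Operations are composed at the level of syntax because the composite must be a single term,
  -- read in two different algebras.
  substitute : ∀ {m n} → Term S m → Vector (Term S n) m → Term S n
  substitute (var i)    σ = σ i
  substitute (app o ts) σ = app o λ i → substitute (ts i) σ

  module _ (𝔸 : Algebra S) where
    open Algebra 𝔸

    eval-substitute : ∀ {m n} (t : Term S m) (σ : Vector (Term S n) m) v →
                      eval (substitute t σ) v ≈ eval t (λ i → eval (σ i) v)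
    eval-substitute (var i)    σ v = refl
    eval-substitute (app o ts) σ v = op-cong o λ i → eval-substitute (ts i) σ v

    -- The tuple is only pointwise `≈` to a constant, so that this covers the pair (b, h(b,a,a)),
    -- whose entries need not coincide on the nose.
    eval-idempotent : IsIdempotent 𝔸 → ∀ {n} (t : Term S n) {v x} →
                      (∀ i → v i ≈ x) → eval t v ≈ x
    eval-idempotent idem (var i)    v≈x = v≈x i
    eval-idempotent idem (app o ts) v≈x =
      trans (op-cong o λ i → eval-idempotent idem (ts i) v≈x) (idem o _)

    -- The term is read off the derivation of membership; a `resp` step keeps the term and only
    -- extends the equality.
    Sg⇒term : ∀ {a b x} → x ∈ Sg 𝔸 a b → ∃[ t ] ⟦ t ⟧₂ a b ≈ x
    Sg⇒term genˡ           = var 0F , refl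
    Sg⇒term genʳ           = var 1F , refl
    Sg⇒term (resp x≈y x∈)  = let t , e = Sg⇒term x∈ in t , trans e x≈y
    Sg⇒term (app o v v∈)   =
      app o (λ i → proj₁ (Sg⇒term (v∈ i))) , op-cong o λ i → proj₂ (Sg⇒term (v∈ i))

module _ {X : Setoid 0ℓ 0ℓ} (M : ModuleStructure X) where
  open Setoid X
  open ModuleStructure M
  open IsLeftModule isLeftModule

  private
    additiveGroup : Group 0ℓ 0ℓ
    additiveGroup = record { isGroup = +ᴹ-isGroup }

  affine-xyy : ∀ x y → affine x y y ≈ x
  -- In the additive group x - y is right division by y, and adding y undoes it.
  affine-xyy x y = GroupProperties.//-rightDividesˡ additiveGroup y x

  affine-yyx : ∀ x y → affine y y x ≈ x
  affine-yyx x y = trans (+ᴹ-cong (-ᴹ‿inverseʳ y) refl) (+ᴹ-identityˡ x)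

module _ {S : Signature} {k : ℕ} (𝒦 : Fin k → Algebra S) (F : FixedOperations 𝒦) where
  open FixedOperations F

  -- The identity is one of those imposed on `h`. On an affine edge `h` is x - y + z for the module
  -- structure of that edge, and cancellation makes this Mal'tsev.
  h-minority : MinorityCondition 𝒦 h
  h-minority = h-identity , maltsev
    where
    maltsev : ∀ i a b θ → IsAffineEdge (𝒦 i) a b θ → IsMaltsev (Sg/ (𝒦 i) a b θ) h
    maltsev i a b θ e x y =
      trans (h≈affine x y y) (affine-xyy moduleStructure x y) ,
      trans (h≈affine y y x) (affine-yyx moduleStructure x y)
      where
      open Algebra (Sg/ (𝒦 i) a b θ) using (trans)
      open IsModule (IsAffineEdge.isModule e) using (moduleStructure)
      h≈affine = proj₂ (proj₂ (onAffine i a b θ e))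

  thinAffine-term : (∀ i → IsIdempotent (𝒦 i)) → ∀ i j →
    let module A₁ = Algebra (𝒦 i)
        module A₂ = Algebra (𝒦 j)
    in ∀ a b c d → IsThinAffineEdge 𝒦 F i a b → IsThinAffineEdge 𝒦 F j c d →
       Σ[ h′ ∈ Term S 3 ]
         (A₁.⟦ h′ ⟧₃ b a a A₁.≈ b) × (A₂.⟦ h′ ⟧₃ c c d A₂.≈ d)
  thinAffine-term idem i j a b c d (_ , hbaa≈b , _) (_ , _ , cd-thin) =
    substitute r σ ,
    A₁.trans (eval-substitute (𝒦 i) r σ _)
             (eval-idempotent (𝒦 i) (idem i) r λ { 0F → A₁.refl ; 1F → hbaa≈b }) ,
    A₂.trans (eval-substitute (𝒦 j) r σ _)
             -- Substitution yields the function i ↦ `eval (σ i)`, which agrees with the vector (c,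
             -- h(c,c,d)) only pointwise; congruence bridges the two.
             (A₂.trans (eval-cong A₂.interpretation r λ { 0F → A₂.refl ; 1F → A₂.refl })
                       rch≈d)
    where
    module A₁ = Algebra (𝒦 i)
    module A₂ = Algebra (𝒦 j)
    r,eq = Sg⇒term (𝒦 j) (cd-thin h h-minority)
    r = proj₁ r,eq
    rch≈d = proj₂ r,eq
    σ : Vector (Term S 3) 2
    σ = var 0F ∷ h ∷ []

lemma4p9 :
  (S : Signature) (k : ℕ) (𝒦 : Fin k → Algebra S) →
  (∀ i → IsFinite (𝒦 i)) → (∀ i → IsIdempotent (𝒦 i)) → (∀ i → IsSmooth (𝒦 i)) →
  (F : FixedOperations 𝒦) →
  (∀ i j →
    let module A₁ = Algebra (𝒦 i)
        module A₂ = Algebra (𝒦 j)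
    in (a b : A₁.Carrier) (c d : A₂.Carrier) →
       IsThinAffineEdge 𝒦 F i a b → IsThinAffineEdge 𝒦 F j c d →
       Σ[ h′ ∈ Term S 3 ]
         (A₁.⟦ h′ ⟧₃ b a a A₁.≈ b) × (A₂.⟦ h′ ⟧₃ c c d A₂.≈ d))
  ×
  (∀ i →
    let open Algebra (𝒦 i)
    in (a b : Carrier) → IsThinAffineEdge 𝒦 F i a b →
       Σ[ h′ ∈ Term S 3 ]
         (⟦ h′ ⟧₃ b a a ≈ b) × (⟦ h′ ⟧₃ a a b ≈ b))
lemma4p9 S k 𝒦 _ idem _ F =
  -- For the second claim take cd to be ab itself, so that both equations have value b.
  thinAffine-term 𝒦 F idem , λ i a b ab → thinAffine-term 𝒦 F idem i i a b a b ab ab
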